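{- Let $G$ be a graph with two distinct non-adjacent vertices $u$ and $v$ such that $N(u)\subseteq N(v)$. Then at least one of the following holds: (i) $G$ is recolorable; (ii) $G-u$ is not recolorable. Furthermore, if $G-u$ is good then $G$ is good.
   Context: All graphs are finite and simple. $N(v)$ is the set of vertices adjacent to $v$. A $k$-coloring of $G$ is a map $V(G)\to\{1,\dots,k\}$ giving adjacent vertices different values; $\chi(G)$ is the chromatic number, and a $\chi$-coloring of $G$ is a $\chi(G)$-coloring. $R_k(G)$ denotes the graph whose vertices are the $k$-colorings of $G$, two being adjacent if they differ in color on exactly one vertex. $G$ is recolorable if $R_\ell(G)$ is connected for all $\ell\ge\chi(G)+1$. A graph $G$ on $n$ vertices is good if there exists a $\chi$-coloring of $G$ which, for all $\ell\ge\chi(G)+1$, can be reached from any coloring in $R_\ell(G)$ by a path in $R_\ell(G)$ along which each vertex is recolored at most $n$ times (for $G-u$, $n$ is the number of vertices of $G-u$). $G-u$ is the graph obtained from $G$ by deleting $u$. -}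

module Defs where

open import Data.Bool.Base using (if_then_else_)
open import Data.Fin.Base using (Fin; inject≤; punchIn; finToFun; funToFin)
open import Data.Fin.Properties
  using (_≟_; any?; all?; inject≤-injective; punchIn-injective; finToFun-funToFin)
open import Data.Nat.Base using (ℕ; zero; suc; _+_; _≤_; _≥_; _^_; z≤n; s≤s)
open import Data.Nat.Properties using (<⇒≤)
open import Data.Product using (Σ-syntax; ∃; ∃!; _×_; _,_; proj₁; proj₂)
open import Function.Base using (_∘_; id)
open import Level using (0ℓ)
open import Relation.Binary.Core using (Rel)
open import Relation.Binary.Definitions using (Decidable; Symmetric; Irreflexive)
open import Relation.Binary.PropositionalEquality
  using (_≡_; _≢_; _≗_; refl; sym; trans)
open import Relation.Nullary using (yes; no; does; ¬?; contradiction)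
open import Relation.Nullary.Decidable using (map′; _→-dec_)
import Relation.Unary as U
open U using (Pred)

record Graph (n : ℕ) : Set₁ where
  infix 4 _~_ _~?_
  field
    _~_    : Rel (Fin n) 0ℓ
    _~?_   : Decidable _~_
    ~-sym  : Symmetric _~_
    ~-irr  : Irreflexive _≡_ _~_

  N : Fin n → Pred (Fin n) 0ℓ
  N v w = v ~ w

infixl 6 _-_

-- The surviving vertices are renumbered along punchIn u : Fin n → Fin (suc n),
-- the increasing injection that misses exactly u.
_-_ : ∀ {n} → Graph (suc n) → Fin (suc n) → Graph n
G - u = record
  { _~_   = λ x y → punchIn u x ~ punchIn u y
  ; _~?_  = λ x y → punchIn u x ~? punchIn u y
  ; ~-sym = ~-sym
  ; ~-irr = λ { refl → ~-irr refl }
  }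
  where open Graph G

Proper : ∀ {n k} → Graph n → Pred (Fin n → Fin k) 0ℓ
Proper G c = ∀ x y → x ~ y → c x ≢ c y
  where open Graph G

record Coloring {n} (G : Graph n) (k : ℕ) : Set where
  constructor mkColoring
  field
    color  : Fin n → Fin k
    proper : Proper G color

open Coloring public

embed : ∀ {n} {G : Graph n} {k ℓ} → k ≤ ℓ → Coloring G k → Coloring G ℓ
embed k≤ℓ c = mkColoring
  (λ x → inject≤ (color c x) k≤ℓ)
  (λ x y x~y → proper c x y x~y ∘ inject≤-injective k≤ℓ k≤ℓ _ _)

coloring? : ∀ {n} (G : Graph n) → U.Decidable (Coloring G)
coloring? {n} G k =
  map′ (λ (i , p) → mkColoring (finToFun i) p)
       (λ c → funToFin (color c) , λ x y x~y e →
          proper c x y x~y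
            (trans (sym (finToFun-funToFin (color c) x))
                   (trans e (finToFun-funToFin (color c) y))))
       (any? {k ^ n} {P = λ i → Proper G (finToFun i)} λ i →
         all? λ x → all? λ y →
           (x ~? y) →-dec ¬? (finToFun {k} {n} i x ≟ finToFun i y))
  where open Graph G

Least : Pred ℕ 0ℓ → Pred ℕ 0ℓ
Least P k = P k × (∀ j → P j → k ≤ j)

least : ∀ {P : Pred ℕ 0ℓ} → U.Decidable P → ∀ n → P n → ∃ (Least P)
least P? zero p = zero , p , λ _ _ → z≤n
least {P} P? (suc n) p with P? zero
... | yes p₀ = zero , p₀ , λ _ _ → z≤n
... | no ¬p₀ with least {P ∘ suc} (P? ∘ suc) n p
...   | k , pk , min = suc k , pk ,
        λ { zero p₀ → contradiction p₀ ¬p₀ ; (suc j) pj → s≤s (min j pj) }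

identityColoring : ∀ {n} (G : Graph n) → Coloring G n
identityColoring G = mkColoring id λ x y x~y x≡y → Graph.~-irr G x≡y x~y

chromatic : ∀ {n} (G : Graph n) → ∃ (Least (Coloring G))
chromatic {n} G = least (coloring? G) n (identityColoring G)

χ : ∀ {n} → Graph n → ℕ
χ = proj₁ ∘ chromatic

χ-least : ∀ {n} (G : Graph n) → Least (Coloring G) (χ G)
χ-least = proj₂ ∘ chromatic

module _ {n} {G : Graph n} {k : ℕ} where

  infix 4 _≈_
  infixr 5 _∷_

  _≈_ : Rel (Coloring G k) 0ℓ
  α ≈ β = color α ≗ color β

  -- Adjacency in the reconfiguration graph R_k(G).
  Step : Rel (Coloring G k) 0ℓ
  Step α β = ∃! _≡_ λ x → color α x ≢ color β x

  -- Walks in R_k(G).  Colorings are functions, so its vertices are the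
  -- colorings up to _≈_; this is why Star Step is not used.
  data Path : Rel (Coloring G k) 0ℓ where
    done : ∀ {α β} → α ≈ β → Path α β
    _∷_  : ∀ {α β γ} → Step α β → Path β γ → Path α γ

  recolorings : ∀ {α β} → Path α β → Fin n → ℕ
  recolorings (done _)      x = 0
  recolorings ((y , _) ∷ p) x = (if does (y ≟ x) then 1 else 0) + recolorings p x

Connected-R : ∀ {n} → ℕ → Graph n → Set
Connected-R k G = (α β : Coloring G k) → Path α β

Recolorable : ∀ {n} → Graph n → Set
Recolorable G = ∀ ℓ → ℓ ≥ suc (χ G) → Connected-R ℓ G

Good : ∀ {n} → Graph n → Set
Good {n} G =
  Σ[ γ ∈ Coloring G (χ G) ]
    ∀ ℓ (ℓ>χ : ℓ ≥ suc (χ G)) (α : Coloring G ℓ) →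
      Σ[ p ∈ Path α (embed (<⇒≤ ℓ>χ) γ) ] (∀ x → recolorings p x ≤ n)

{-# OPTIONS --safe #-}
-- Since N(u) ⊆ N(v), sending u to v is a graph homomorphism G → G - u fixing
-- every other vertex.  Colorings pull back along it, so χ(G) = χ(G - u), and so
-- do walks: u imitates every recoloring of v.  Every coloring of G is at most
-- one recoloring (of u) away from a pulled-back one.  This shows that G is
-- recolorable, or good, as soon as G - u is.
--
-- Constructively, the disjunction also asks to decide whether G - u is
-- recolorable.  R_ℓ is connected once ℓ exceeds twice the number of vertices,
-- and the remaining finitely many connectivity questions are settled by
-- Warshall's algorithm.
module Submission where

open import Defs
open import Data.Bool.Base using (if_then_else_)
open import Data.Fin.Base using (Fin; punchIn; punchOut; finToFun; funToFin; _↑ˡ_; _↑ʳ_)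
open import Data.Fin.Properties
  using (_≟_; any?; all?; punchIn-punchOut; punchOut-punchIn; punchOut-cong; punchInᵢ≢i;
         finToFun-funToFin; <⇒notInjective)
open import Data.List.Base as List using (List; []; allFin; mapMaybe)
import Data.List.Relation.Unary.All as All
open import Data.List.Relation.Unary.Any as Any using (Any; here; there)
import Data.List.Relation.Unary.Any.Properties as Any
open import Data.List.Membership.Propositional using (_∈_; find; lose)
open import Data.List.Membership.Propositional.Properties using (∈-allFin)
open import Data.Maybe.Base as Maybe using (Maybe)
import Data.Maybe.Relation.Unary.Any as MaybeAny
open import Data.Nat.Base using (ℕ; suc; _+_; _≤_; _<_; _≥_; _^_; z≤n)
open import Data.Nat.Properties
  using (≤-refl; ≤-trans; ≤-reflexive; ≤-antisym; <⇒≤; ≮⇒≥; _<?_; _≤?_; +-mono-≤;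
         +-assoc; +-identityʳ; allUpTo?)
open import Data.Product.Base using (Σ-syntax; ∃-syntax; _×_; _,_; proj₁; proj₂)
open import Data.Sum.Base using (_⊎_; inj₁; inj₂)
open import Data.Vec.Functional using (updateAt; _++_)
open import Data.Vec.Functional.Properties
  using (updateAt-updates; updateAt-minimal; lookup-++ˡ; lookup-++ʳ)
open import Function.Base using (_∘_; const)
open import Level using (0ℓ)
open import Relation.Binary.Core using (Rel)
open import Relation.Binary.Definitions using (Decidable)
open import Relation.Binary.PropositionalEquality
  using (_≡_; _≢_; refl; sym; trans; cong; subst; ≢-sym)
open import Relation.Nullary using (¬_; Dec; yes; no; does; ¬?; contradiction)
open import Relation.Nullary.Decidable
  using (map′; _×-dec_; _⊎-dec_; _→-dec_; decidable-stable; dec⇒maybe)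
open import Relation.Unary using (_⊆_)

-- Warshall's algorithm for a decidable relation.

module Warshall {A : Set} {R : Rel A 0ℓ} (R? : Decidable R) where

  -- Chains of at least one `R`-step whose intermediate points lie in the list, split by whether
  -- they pass through its head. One visit to the head suffices, since loops can be cut out; hence
  -- the recursion on the list makes reachability decidable without bounding lengths.
  Reach : List A → Rel A 0ℓ
  Reach []             x y = R x y
  Reach (w List.∷ ws) x y = Reach ws x y ⊎ (Reach ws x w × Reach ws w y)

  reach? : ∀ ws → Decidable (Reach ws)
  reach? []             x y = R? x y
  reach? (w List.∷ ws) x y = reach? ws x y ⊎-dec (reach? ws x w ×-dec reach? ws w y)

  R⇒Reach : ∀ ws {x y} → R x y → Reach ws x y
  R⇒Reach []             r = r
  R⇒Reach (_ List.∷ ws) r = inj₁ (R⇒Reach ws r)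

  Reach-fold : ∀ {S : Rel A 0ℓ} → (∀ {x y} → R x y → S x y) →
               (∀ {x y z} → S x y → S y z → S x z) →
               ∀ ws {x y} → Reach ws x y → S x y
  Reach-fold R⇒S S-trans []             r              = R⇒S r
  Reach-fold R⇒S S-trans (_ List.∷ ws) (inj₁ r)       = Reach-fold R⇒S S-trans ws r
  Reach-fold R⇒S S-trans (_ List.∷ ws) (inj₂ (r , s)) =
    S-trans (Reach-fold R⇒S S-trans ws r) (Reach-fold R⇒S S-trans ws s)

  -- If `y` is the head, the first chain is cut at its first visit there, the second is kept from
  -- its last visit on, and the pieces are glued. If `y` comes later and both chains visit the head,
  -- the loop between the two visits is dropped, and `y` with it.
  Reach-trans : ∀ ws {x y z} → y ∈ ws → Reach ws x y → Reach ws y z → Reach ws x z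
  Reach-trans (_ List.∷ ws) (here refl) (inj₁ r)       (inj₁ s)       = inj₂ (r , s)
  Reach-trans (_ List.∷ ws) (here refl) (inj₁ r)       (inj₂ (_ , s)) = inj₂ (r , s)
  Reach-trans (_ List.∷ ws) (here refl) (inj₂ (r , _)) (inj₁ s)       = inj₂ (r , s)
  Reach-trans (_ List.∷ ws) (here refl) (inj₂ (r , _)) (inj₂ (_ , s)) = inj₂ (r , s)
  Reach-trans (_ List.∷ ws) (there y∈)  (inj₁ r)       (inj₁ s)       =
    inj₁ (Reach-trans ws y∈ r s)
  Reach-trans (_ List.∷ ws) (there y∈)  (inj₁ r)       (inj₂ (s , t)) =
    inj₂ (Reach-trans ws y∈ r s , t)
  Reach-trans (_ List.∷ ws) (there y∈)  (inj₂ (r , s)) (inj₁ t)       =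
    inj₂ (r , Reach-trans ws y∈ s t)
  Reach-trans (_ List.∷ ws) (there y∈)  (inj₂ (r , _)) (inj₂ (_ , t)) = inj₂ (r , t)

-- Walks and their recoloring counts.

δ : ∀ {n} → Fin n → Fin n → ℕ
δ x y = if does (x ≟ y) then 1 else 0

δ≤1 : ∀ {n} (x y : Fin n) → δ x y ≤ 1
δ≤1 x y with x ≟ y
... | yes _ = ≤-refl
... | no  _ = z≤n

1≤δ : ∀ {n} {x y : Fin n} → x ≡ y → 1 ≤ δ x y
1≤δ {x = x} {y} x≡y with x ≟ y
... | yes _   = ≤-refl
... | no  x≢y = contradiction x≡y x≢y

δ-≤ : ∀ {n} {x : Fin n} (f : Fin n → ℕ) → 1 ≤ f x → ∀ y → δ x y ≤ f y
δ-≤ {x = x} f 1≤fx y with x ≟ y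
... | yes refl = 1≤fx
... | no  _    = z≤n

-- The two indicators never overlap. Thus one recoloring at `v` and one at `u` can both be charged
-- to a single recoloring of their common image under `fold`.
δ+δ-≤ : ∀ {n} {x₁ x₂ : Fin n} (f : Fin n → ℕ) → x₁ ≢ x₂ → 1 ≤ f x₁ → 1 ≤ f x₂ →
        ∀ y → δ x₁ y + δ x₂ y ≤ f y
δ+δ-≤ {x₁ = x₁} {x₂} f x₁≢x₂ 1≤fx₁ 1≤fx₂ y with x₁ ≟ y | x₂ ≟ y
... | yes refl | yes refl = contradiction refl x₁≢x₂
... | yes refl | no _     = 1≤fx₁
... | no _     | yes refl = 1≤fx₂
... | no _     | no _     = z≤n

module _ {n} {G : Graph n} {k : ℕ} where
  open Graph G

  Step⇒Path : (α β : Coloring G k) → Step α β → Path α β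
  Step⇒Path α β s = _∷_ {β = β} s (done λ _ → refl)

  -- The pointwise equality is absorbed into the final equality or into the first step, so that it
  -- adds nothing to the counts.
  ≈-path : {α β γ : Coloring G k} → α ≈ β → Path β γ → Path α γ
  ≈-path e (done f)            = done λ x → trans (e x) (f x)
  ≈-path e ((x , ne , un) ∷ p) =
    (x , ne ∘ trans (sym (e x)) , λ {y} ne′ → un (ne′ ∘ trans (e y))) ∷ p

  recolorings-≈-path : {α β γ : Coloring G k} (e : α ≈ β) (p : Path β γ) →
                       ∀ x → recolorings (≈-path {α} e p) x ≡ recolorings p x
  recolorings-≈-path e (done _) x = refl
  recolorings-≈-path e (_ ∷ _)  x = refl

  infixr 5 _∙_
  _∙_ : {α β γ : Coloring G k} → Path α β → Path β γ → Path α γ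
  done e  ∙ q = ≈-path e q
  (s ∷ p) ∙ q = s ∷ (p ∙ q)

  recolorings-∙ : {α β γ : Coloring G k} (p : Path α β) (q : Path β γ) →
                  ∀ x → recolorings (p ∙ q) x ≡ recolorings p x + recolorings q x
  recolorings-∙ {α} (done e)  q x = recolorings-≈-path {α} e q x
  recolorings-∙ ((y , _) ∷ p) q x =
    trans (cong (δ y x +_) (recolorings-∙ p q x)) (sym (+-assoc (δ y x) _ _))

  -- The bound varies with the vertex, so that bounds can be added under composition and pulled back
  -- along `fold`.
  Path≤ : (Fin n → ℕ) → Rel (Coloring G k) 0ℓ
  Path≤ f α β = Σ[ p ∈ Path α β ] (∀ x → recolorings p x ≤ f x)

  weaken : ∀ {f g} {α β : Coloring G k} → (∀ x → f x ≤ g x) → Path≤ f α β → Path≤ g α β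
  weaken f≤g (p , p≤f) = p , λ x → ≤-trans (p≤f x) (f≤g x)

  infixr 5 _∙≤_
  _∙≤_ : ∀ {f g} {α β γ : Coloring G k} →
         Path≤ f α β → Path≤ g β γ → Path≤ (λ x → f x + g x) α γ
  (p , p≤f) ∙≤ (q , q≤g) = p ∙ q , λ x →
    ≤-trans (≤-reflexive (recolorings-∙ p q x)) (+-mono-≤ (p≤f x) (q≤g x))

  AgreeOff : Fin n → Rel (Coloring G k) 0ℓ
  AgreeOff x α β = ∀ y → y ≢ x → color α y ≡ color β y

  Step⇒AgreeOff : {α β : Coloring G k} ((x , _) : Step α β) → AgreeOff x α β
  Step⇒AgreeOff {α} {β} (x , _ , un) y y≢x =
    decidable-stable (color α y ≟ color β y) (y≢x ∘ sym ∘ un)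

  -- A `Step` must really change a color, so the walk is empty when the colors at `x` happen to
  -- agree. This is why the count is bounded rather than determined.
  AgreeOff⇒Path≤ : (α β : Coloring G k) (x : Fin n) → AgreeOff x α β → Path≤ (δ x) α β
  AgreeOff⇒Path≤ α β x off with color α x ≟ color β x
  ... | yes e = done agree , λ _ → z≤n
    where
    agree : α ≈ β
    agree y with y ≟ x
    ... | yes refl = e
    ... | no  y≢x  = off y y≢x
  ... | no ne =
    Step⇒Path α β (x , ne , unique) , λ y → ≤-reflexive (+-identityʳ (δ x y))
    where
    unique : ∀ {y} → color α y ≢ color β y → x ≡ y
    unique {y} ne′ = sym (decidable-stable (y ≟ x) (ne′ ∘ off y))

  recolor : (α : Coloring G k) (x : Fin n) (c : Fin k) →
            (∀ y → x ~ y → color α y ≢ c) → Coloring G k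
  recolor α x c free = mkColoring new new-proper
    where
    new : Fin n → Fin k
    new = updateAt (color α) x (const c)

    new-at : new x ≡ c
    new-at = updateAt-updates x (color α)

    new-off : ∀ {y} → y ≢ x → new y ≡ color α y
    new-off {y} = updateAt-minimal y x (color α)

    new-proper : Proper G new
    new-proper y z y~z e with y ≟ x | z ≟ x
    ... | yes refl | yes refl = ~-irr refl y~z
    ... | yes refl | no z≢x   =
      free z y~z (trans (sym (new-off z≢x)) (trans (sym e) new-at))
    ... | no y≢x   | yes refl =
      free y (~-sym y~z) (trans (sym (new-off y≢x)) (trans e new-at))
    ... | no y≢x   | no z≢x   =
      proper α y z y~z (trans (sym (new-off y≢x)) (trans e (new-off z≢x)))

  module _ (α : Coloring G k) (x : Fin n) (c : Fin k) (free : ∀ y → x ~ y → color α y ≢ c)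
    where

    recolor-at : color (recolor α x c free) x ≡ c
    recolor-at = updateAt-updates x (color α)

    recolor-off : AgreeOff x (recolor α x c free) α
    recolor-off y = updateAt-minimal y x (color α)

-- Connectivity with more than twice as many colors as vertices.

fresh : ∀ {m k} → m < k → (f : Fin m → Fin k) → ∃[ c ] ∀ i → f i ≢ c
fresh m<k f with any? (λ c → all? λ i → ¬? (f i ≟ c))
... | yes found = found
-- Pigeonhole: if every color were hit, choosing preimages would inject the `k` colors into the `m`
-- arguments.
... | no  none  = contradiction (λ {c} {d} → preimage-injective {c} {d}) (<⇒notInjective m<k)
  where
  hit : ∀ c → ∃[ i ] f i ≡ c
  hit c = decidable-stable (any? λ i → f i ≟ c) λ miss → none (c , λ i e → miss (i , e))

  preimage-injective : ∀ {c d} → proj₁ (hit c) ≡ proj₁ (hit d) → c ≡ d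
  preimage-injective {c} {d} e =
    trans (sym (proj₂ (hit c))) (trans (cong f e) (proj₂ (hit d)))

module _ {n} {G : Graph n} {k : ℕ} (2n<k : n + n < k) where
  open Graph G

  -- Both ends are moved, one vertex at a time, to a color which neither uses.
  meet : ∀ xs (α β : Coloring G k) → (∀ y → y ∈ xs ⊎ color α y ≡ color β y) → Path α β
  meet [] α β h = done λ y → agree (h y)
    where
    agree : ∀ {y} → y ∈ [] ⊎ color α y ≡ color β y → color α y ≡ color β y
    agree (inj₂ e) = e
  meet (x List.∷ xs) α β h =
    proj₁ (AgreeOff⇒Path≤ α α′ x λ y → sym ∘ recolor-off α x c free-α y) ∙
    meet xs α′ β′ h′ ∙
    proj₁ (AgreeOff⇒Path≤ β′ β x (recolor-off β x c free-β))
    where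
    c : Fin k
    c = proj₁ (fresh 2n<k (color α ++ color β))

    c-fresh : ∀ i → (color α ++ color β) i ≢ c
    c-fresh = proj₂ (fresh 2n<k (color α ++ color β))

    free-α : ∀ y → x ~ y → color α y ≢ c
    free-α y _ = c-fresh (y ↑ˡ n) ∘ trans (lookup-++ˡ (color α) (color β) y)

    free-β : ∀ y → x ~ y → color β y ≢ c
    free-β y _ = c-fresh (n ↑ʳ y) ∘ trans (lookup-++ʳ (color α) (color β) y)

    α′ β′ : Coloring G k
    α′ = recolor α x c free-α
    β′ = recolor β x c free-β

    h′ : ∀ y → y ∈ xs ⊎ color α′ y ≡ color β′ y
    h′ y with y ≟ x | h y
    ... | yes refl | _              =
      inj₂ (trans (recolor-at α x c free-α) (sym (recolor-at β x c free-β)))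
    ... | no y≢x   | inj₁ (here e)  = contradiction e y≢x
    ... | no y≢x   | inj₁ (there i) = inj₁ i
    ... | no y≢x   | inj₂ e         =
      inj₂ (trans (recolor-off α x c free-α y y≢x)
                  (trans e (sym (recolor-off β x c free-β y y≢x))))

  many-colors⇒connected : Connected-R k G
  many-colors⇒connected α β = meet (allFin n) α β (inj₁ ∘ ∈-allFin)

-- Deciding connectivity and recolorability.

module _ {n} (G : Graph n) (k : ℕ) where
  open Graph G

  proper? : ∀ (c : Fin n → Fin k) → Dec (Proper G c)
  proper? c = all? λ x → all? λ y → (x ~? y) →-dec ¬? (c x ≟ c y)

  decode : Fin (k ^ n) → Maybe (Coloring G k)
  decode i = Maybe.map (mkColoring (finToFun i)) (dec⇒maybe (proper? (finToFun i)))

  colorings : List (Coloring G k)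
  colorings = mapMaybe decode (allFin (k ^ n))

  -- Stated up to `_≈_` because decoding the code of `α` restores its values only pointwise, with a
  -- properness proof of its own.
  colorings-complete : ∀ α → Any (α ≈_) colorings
  colorings-complete α =
    Any.mapMaybe⁺ decode _ (Any.map⁺ (lose (∈-allFin (funToFin (color α))) decoded))
    where
    α≗ : ∀ x → color α x ≡ finToFun (funToFin (color α)) x
    α≗ x = sym (finToFun-funToFin (color α) x)

    decoded : MaybeAny.Any (α ≈_) (decode (funToFin (color α)))
    decoded with proper? (finToFun (funToFin (color α)))
    ... | yes _  = MaybeAny.just α≗
    ... | no  ¬p = contradiction
      (λ x y x~y e → proper α x y x~y (trans (α≗ x) (trans e (sym (α≗ y))))) ¬p

  step? : Decidable (Step {G = G} {k})
  step? α β = map′ (λ (x , ne , un) → x , ne , λ {y} → un y) (λ (x , ne , un) → x , ne , λ y → un)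
    (any? λ x → ¬? (color α x ≟ color β x) ×-dec
                all? λ y → ¬? (color α y ≟ color β y) →-dec (x ≟ y))

  private
    -- `Reach` has no empty chains, so `_≈_` is included to account for walks without steps.
    R : Rel (Coloring G k) 0ℓ
    R α β = α ≈ β ⊎ Step α β

    open Warshall {R = R}
      (λ α β → (all? λ x → color α x ≟ color β x) ⊎-dec step? α β)

  Reach⇒Path : ∀ {α β} → Reach colorings α β → Path α β
  Reach⇒Path = Reach-fold
    (λ { (inj₁ e) → done e ; (inj₂ s) → Step⇒Path _ _ s }) _∙_ colorings

  -- `Reach-trans` composes only at listed points. Each coloring met on the walk is therefore
  -- replaced by its listed copy, and the induction continues from that copy; this is why the start
  -- is generalized along `_≈_`.
  Path⇒Reach : ∀ {α β γ} → α ≈ β → Path β γ → Reach colorings α γ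
  Path⇒Reach e (done f) = R⇒Reach colorings (inj₁ λ x → trans (e x) (f x))
  Path⇒Reach {α} e (_∷_ {β = β} (x , ne , un) p) with find (colorings-complete β)
  ... | β′ , β′∈ , β≈β′ = Reach-trans colorings β′∈
    (R⇒Reach colorings (inj₂
      ( x
      , (λ e′ → ne (trans (sym (e x)) (trans e′ (sym (β≈β′ x)))))
      , λ {y} ne′ → un λ e′ → ne′ (trans (e y) (trans e′ (β≈β′ y))))))
    (Path⇒Reach (λ y → sym (β≈β′ y)) p)

  path? : Decidable (Path {G = G} {k})
  path? α β = map′ Reach⇒Path (Path⇒Reach λ _ → refl) (reach? colorings α β)

  connected? : Dec (Connected-R k G)
  connected? = map′ from (λ conn → All.universal (λ α → All.universal (conn α) _) _)
    (All.all? (λ α → All.all? (path? α) colorings) colorings)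
    where
    from : All.All (λ α → All.All (Path α) colorings) colorings → Connected-R k G
    from ps α β with find (colorings-complete α) | find (colorings-complete β)
    ... | α′ , α′∈ , α≈α′ | β′ , β′∈ , β≈β′ =
      ≈-path α≈α′ (All.lookup (All.lookup ps α′∈) β′∈ ∙ done λ x → sym (β≈β′ x))

recolorable? : ∀ {n} (G : Graph n) → Dec (Recolorable G)
recolorable? {n} G = map′ from (λ rec {ℓ} _ → rec ℓ)
  -- The bound is strict: every `ℓ` up to and including `n + n` is tested, and any other satisfies
  -- the hypothesis of `many-colors⇒connected`.
  (allUpTo? (λ ℓ → (suc (χ G) ≤? ℓ) →-dec connected? G ℓ) (suc (n + n)))
  where
  from : (∀ {ℓ} → ℓ < suc (n + n) → ℓ ≥ suc (χ G) → Connected-R ℓ G) → Recolorable G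
  from few ℓ ℓ>χ with ℓ <? suc (n + n)
  ... | yes ℓ≤2n = few ℓ≤2n ℓ>χ
  ... | no  ℓ≰2n = many-colors⇒connected (≮⇒≥ ℓ≰2n)

-- Folding `u` onto `v` and transferring walks from `G - u` to `G`.

GoodFor : ∀ {n} → Graph n → ℕ → Set
GoodFor {n} G k =
  Σ[ γ ∈ Coloring G k ] ∀ ℓ (ℓ>k : ℓ ≥ suc k) (α : Coloring G ℓ) →
    Path≤ (const n) α (embed (<⇒≤ ℓ>k) γ)

module Fold {n} (G : Graph (suc n)) {u v : Fin (suc n)} (u≢v : u ≢ v)
            (Nu⊆Nv : Graph.N G u ⊆ Graph.N G v) where
  open Graph G

  v′ : Fin n
  v′ = punchOut u≢v

  fold : Fin (suc n) → Fin n
  fold x with u ≟ x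
  ... | yes _   = v′
  ... | no  u≢x = punchOut u≢x

  fold-u : fold u ≡ v′
  fold-u with u ≟ u
  ... | yes _   = refl
  ... | no  u≢u = contradiction refl u≢u

  punchIn-fold : ∀ {x} → x ≢ u → punchIn u (fold x) ≡ x
  punchIn-fold {x} x≢u with u ≟ x
  ... | yes u≡x = contradiction (sym u≡x) x≢u
  ... | no  u≢x = punchIn-punchOut u≢x

  fold-punchIn : ∀ y → fold (punchIn u y) ≡ y
  fold-punchIn y with u ≟ punchIn u y
  ... | yes e  = contradiction (sym e) (punchInᵢ≢i u y)
  ... | no  ne = trans (punchOut-cong u refl) (punchOut-punchIn u)

  fold-v : fold v ≡ v′
  fold-v = trans (cong fold (sym (punchIn-punchOut u≢v))) (fold-punchIn v′)

  fold≡v′ : ∀ {x} → x ≢ u → fold x ≡ v′ → x ≡ v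
  fold≡v′ x≢u e =
    trans (sym (punchIn-fold x≢u)) (trans (cong (punchIn u) e) (punchIn-punchOut u≢v))

  -- Only edges at `u` change. Such an edge goes to one at `v` by `Nu⊆Nv`, and its other end stays
  -- fixed because it is not `u`.
  fold-~ : ∀ {x y} → x ~ y → Graph._~_ (G - u) (fold x) (fold y)
  fold-~ {x} {y} x~y with u ≟ x | u ≟ y
  ... | yes refl | yes refl = contradiction x~y (~-irr refl)
  ... | yes refl | no u≢y
    rewrite punchIn-punchOut u≢v | punchIn-punchOut u≢y = Nu⊆Nv x~y
  ... | no u≢x   | yes refl
    rewrite punchIn-punchOut u≢v | punchIn-punchOut u≢x = ~-sym (Nu⊆Nv (~-sym x~y))
  ... | no u≢x   | no u≢y
    rewrite punchIn-punchOut u≢x | punchIn-punchOut u≢y = x~y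

  module _ {k : ℕ} where

    unfold : Coloring (G - u) k → Coloring G k
    unfold γ = mkColoring (color γ ∘ fold) λ x y x~y → proper γ _ _ (fold-~ x~y)

    restrict : Coloring G k → Coloring (G - u) k
    restrict α = mkColoring (color α ∘ punchIn u) λ x y → proper α _ _

    unfold-restrict : ∀ α → AgreeOff u α (unfold (restrict α))
    unfold-restrict α x x≢u = cong (color α) (sym (punchIn-fold x≢u))

    to-unfold : ∀ α → Path≤ (δ u) α (unfold (restrict α))
    to-unfold α = AgreeOff⇒Path≤ α (unfold (restrict α)) u (unfold-restrict α)

    from-unfold : ∀ α → Path≤ (δ u) (unfold (restrict α)) α
    from-unfold α = AgreeOff⇒Path≤ (unfold (restrict α)) α u λ x → sym ∘ unfold-restrict α x

    -- The fiber of `fold` over `v′` consists of `u` and `v`; every other fiber is a single vertex.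
    -- So a change at `v′` is imitated first at `v` and then at `u`, through `mid`, and any other
    -- change by one recoloring.
    unfold-step : ∀ γ₁ γ₂ (x : Fin n) → AgreeOff x γ₁ γ₂ →
                  Path≤ (δ x ∘ fold) (unfold γ₁) (unfold γ₂)
    unfold-step γ₁ γ₂ x off with x ≟ v′
    ... | no x≢v′ = weaken (δ-≤ (δ x ∘ fold) (1≤δ (sym (fold-punchIn x))))
                      (AgreeOff⇒Path≤ (unfold γ₁) (unfold γ₂) (punchIn u x) off′)
      where
      off′ : AgreeOff (punchIn u x) (unfold γ₁) (unfold γ₂)
      off′ y y≢ = off (fold y) fold≢
        where
        fold≢ : fold y ≢ x
        fold≢ e with y ≟ u
        ... | yes refl = x≢v′ (trans (sym e) fold-u)
        ... | no  y≢u  = y≢ (trans (sym (punchIn-fold y≢u)) (cong (punchIn u) e))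
    ... | yes refl =
      weaken (δ+δ-≤ (δ v′ ∘ fold) (≢-sym u≢v) (1≤δ (sym fold-v)) (1≤δ (sym fold-u)))
        (AgreeOff⇒Path≤ (unfold γ₁) mid v
           (λ y → sym ∘ recolor-off (unfold γ₁) v (color γ₂ v′) free y) ∙≤
         AgreeOff⇒Path≤ mid (unfold γ₂) u off′)
      where
      -- A neighbor `y` of `v` folds to a neighbor of `v′`, hence not to `v′` itself. There `γ₁`
      -- agrees with `γ₂`, whose properness keeps that color different from the new one.
      free : ∀ y → v ~ y → color γ₁ (fold y) ≢ color γ₂ v′
      free y v~y e = proper γ₂ _ _ v′~y
        (trans (sym e) (off (fold y) λ e′ → Graph.~-irr (G - u) (sym e′) v′~y))
        where
        v′~y : Graph._~_ (G - u) v′ (fold y)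
        v′~y = subst (λ z → Graph._~_ (G - u) z (fold y)) fold-v (fold-~ v~y)

      mid : Coloring G k
      mid = recolor (unfold γ₁) v (color γ₂ v′) free

      off′ : AgreeOff u mid (unfold γ₂)
      off′ y y≢u with y ≟ v
      ... | yes refl =
        trans (recolor-at (unfold γ₁) v (color γ₂ v′) free) (cong (color γ₂) (sym fold-v))
      ... | no  y≢v  =
        trans (recolor-off (unfold γ₁) v (color γ₂ v′) free y y≢v)
              (off (fold y) (y≢v ∘ fold≡v′ y≢u))

    unfold-path : ∀ {γ₁ γ₂} (p : Path γ₁ γ₂) →
                  Path≤ (recolorings p ∘ fold) (unfold γ₁) (unfold γ₂)
    unfold-path (done e)        = done (e ∘ fold) , λ _ → z≤n
    unfold-path (_∷_ {α} {β} s@(x , _) p) =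
      unfold-step α β x (Step⇒AgreeOff {α = α} {β} s) ∙≤ unfold-path p

  χ-fold : χ (G - u) ≡ χ G
  χ-fold = ≤-antisym
    (proj₂ (χ-least (G - u)) _ (restrict (proj₁ (χ-least G))))
    (proj₂ (χ-least G) _ (unfold (proj₁ (χ-least (G - u)))))

  fold-recolorable : Recolorable (G - u) → Recolorable G
  fold-recolorable rec ℓ ℓ>χ α β =
    proj₁ (to-unfold α) ∙
    proj₁ (unfold-path (rec ℓ (subst (λ k → ℓ ≥ suc k) (sym χ-fold) ℓ>χ)
                            (restrict α) (restrict β))) ∙
    proj₁ (from-unfold β)

  -- The bound grows by exactly the one vertex gained: at most one recoloring of `u` reaches a
  -- pulled-back coloring, and the lifted walk then recolors each vertex at most `n` times.
  -- Extending the palette by `embed` commutes with `unfold` definitionally, so the lifted walk ends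
  -- at the right target.
  fold-goodFor : ∀ {k} → GoodFor (G - u) k → GoodFor G k
  fold-goodFor (γ , reach) = unfold γ , λ ℓ ℓ>k α →
    let p , p≤n = reach ℓ ℓ>k (restrict α) in
    weaken (λ x → +-mono-≤ (δ≤1 u x) (p≤n (fold x))) (to-unfold α ∙≤ unfold-path p)

  fold-good : Good (G - u) → Good G
  -- `Good G` unfolds to `GoodFor G (χ G)`. With the number of colors as a parameter, the equality
  -- of chromatic numbers is needed only once, here.
  fold-good = subst (GoodFor G) χ-fold ∘ fold-goodFor

lemma3 : ∀ {n : ℕ} (G : Graph (suc n)) (u v : Fin (suc n)) →
    u ≢ v → ¬ (Graph._~_ G u v) → Graph.N G u ⊆ Graph.N G v →
    (Recolorable G ⊎ ¬ Recolorable (G - u)) × (Good (G - u) → Good G)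
lemma3 G u v u≢v _ Nu⊆Nv = recolorable-or-not (recolorable? (G - u)) , fold-good
  where
  open Fold G u≢v Nu⊆Nv
  recolorable-or-not : Dec (Recolorable (G - u)) → Recolorable G ⊎ ¬ Recolorable (G - u)
  recolorable-or-not (yes rec) = inj₁ (fold-recolorable rec)
  recolorable-or-not (no ¬rec) = inj₂ ¬rec
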